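{- For every real $\alpha$ and every positive integer $n$, every graph on $n$ vertices with at least $\frac{n^2}{8} + 10^{10}\alpha n$ edges contains either a copy of $K_4$ or an independent set of size greater than $\alpha$. -}

module Defs where

open import Data.Nat using (ℕ; _^_)
open import Data.Bool using (Bool; true; false; if_then_else_; _∧_)
open import Data.Fin using (Fin; _<?_)
open import Data.List using (List; map; allFin)
open import Data.Nat.ListAction using (sum)
open import Data.Integer using (+_)
open import Data.Rational using (ℚ; _/_; _+_; _*_)
open import Data.Product using (Σ; _×_)
open import Function.Definitions using (Injective)
open import Relation.Binary.PropositionalEquality using (_≡_; _≢_)
open import Relation.Nullary using (does)

record Graph (n : ℕ) : Set where
  field
    adj     : Fin n → Fin n → Bool
    adj-sym : ∀ i j → adj i j ≡ adj j i
    irrefl  : ∀ i → adj i i ≡ false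
open Graph public

edgeCount : ∀ {n} → Graph n → ℕ
edgeCount {n} G =
  sum (map (λ i → sum (map (λ j → if does (i <? j) ∧ adj G i j then 1 else 0) (allFin n))) (allFin n))

ℕ→ℚ : ℕ → ℚ
ℕ→ℚ k = + k / 1

HasClique : ∀ {n} → Graph n → ℕ → Set
HasClique {n} G k = Σ (Fin k → Fin n) λ f →
  Injective _≡_ _≡_ f × (∀ i j → i ≢ j → adj G (f i) (f j) ≡ true)

HasIndependentSet : ∀ {n} → Graph n → ℕ → Set
HasIndependentSet {n} G k = Σ (Fin k → Fin n) λ f →
  Injective _≡_ _≡_ f × (∀ i j → i ≢ j → adj G (f i) (f j) ≡ false)

C : ℚ
C = ℕ→ℚ (10 ^ 10)

{-# OPTIONS --safe #-}
module Submission where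

-- Let a = ⌊α⌋ and suppose that G has no K₄ and no independent set of more than a vertices. Then an
-- edge has codegree at most a, and hence, for every vertex set S, the vertices adjacent to more
-- than |S| / 2 + a / 2 of S form an independent set (so there are at most a of them), while those
-- adjacent to more than |S| / 3 + a of S span no triangle (so each has at most a neighbours among
-- them). Deleting vertices of low degree, one may assume minimum degree n / 4 + Ω(a). Starting from
-- S = V, repeatedly replace S by S ∩ N(x) for a suitable x: after 8 steps only about n / 2 vertices
-- have more than a neighbours in S. They are adjacent to half of S on average, so almost all of them
-- see more than a third of S. This yields a sparse set of almost n / 2 vertices, hence a partition
-- of V into two sparse sets Y and Z. For edges pq in Y and rs in Z, the neighbourhoods of p and q in
-- Z, and those of r and s in Y, are nearly disjoint; so the four degrees sum to at most n + O(a),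
-- against the minimum degree.

open import Defs
open import Data.Bool as Bool using (Bool; true; false; if_then_else_; _∧_; not)
open import Data.Bool.Properties using (T-≡)
open import Data.Empty using (⊥; ⊥-elim)
open import Data.Fin as Fin using (Fin; zero; suc; fromℕ<; punchIn)
open import Data.Fin.Patterns using (0F; 1F; 2F; 3F)
import Data.Fin.Properties as Fin
open import Data.Fin.Properties using (any?; all?; punchIn-injective)
open import Data.Fin.Subset.Properties using (anySubset?)
import Data.Integer as ℤ
import Data.Integer.Properties as ℤ
open import Data.List as List using ([]; _∷_)
open import Data.List.Properties using (map-tabulate)
open import Data.Nat
open import Data.Nat.DivMod using (m≡m%n+[m/n]*n; m%n<n; m/n*n≤m)
import Data.Nat.ListAction as ListAction
open import Data.Nat.Properties
open import Data.Nat.Tactic.RingSolver using (solve)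
open import Data.Product using (Σ; ∃; ∃₂; _×_; _,_; proj₁; proj₂)
open import Data.Rational as ℚ using (ℚ; mkℚ; toℚᵘ)
import Data.Rational.Properties as ℚ
open import Data.Rational.Unnormalised as ℚᵘ using (mkℚᵘ)
import Data.Rational.Unnormalised.Properties as ℚᵘ
open import Data.Sum as Sum using (_⊎_; inj₁; inj₂)
open import Data.Vec using (lookup; tabulate)
open import Data.Vec.Properties using (lookup∘tabulate)
open import Function using (_∘_; id; Equivalence)
open import Function.Definitions using (Injective)
open import Relation.Binary.PropositionalEquality
open import Relation.Nullary using (Dec; yes; no; does; contradiction)
open import Relation.Nullary.Decidable using (_×-dec_; _→-dec_)
open import Algebra.Properties.Semiring.Sum +-*-semiring
  using (sum; sum-cong-≗; sum-remove; ∑-distrib-+; ∑-comm; *-distribˡ-sum)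

-- Linear arithmetic on natural numbers.

infixl 6 _⊕_
infixr 7 _⊙_

_⊕_ : ∀ {x y u v} → x ≤ y → u ≤ v → x + u ≤ y + v
_⊕_ = +-mono-≤

_⊙_ : ∀ k {x y} → x ≤ y → k * x ≤ k * y
k ⊙ p = *-monoʳ-≤ k p

-- A linear-arithmetic certificate: L ≤ R is a combination of the hypotheses with nonnegative
-- coefficients, and k x + (R - L) + s = k y is moved around so that no subtraction occurs.
linear : ∀ k .{{_ : NonZero k}} {x y L R} s → L ≤ R → k * x + R + s ≡ k * y + L → x ≤ y
linear k {x} {y} {L} {R} s L≤R eq = *-cancelˡ-≤ k (+-cancelʳ-≤ R (k * x) (k * y) (begin
  k * x + R      ≤⟨ m≤m+n _ s ⟩
  k * x + R + s  ≡⟨ eq ⟩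
  k * y + L      ≤⟨ +-monoʳ-≤ (k * y) L≤R ⟩
  k * y + R      ∎))
  where open ≤-Reasoning

-- Boolean comparisons, finite sums and counting.

<ᵇ-true⇒< : ∀ {x y} → (x <ᵇ y) ≡ true → x < y
<ᵇ-true⇒< {x} {y} eq = <ᵇ⇒< x y (Equivalence.from T-≡ eq)

<⇒<ᵇ-true : ∀ {x y} → x < y → (x <ᵇ y) ≡ true
<⇒<ᵇ-true x<y = Equivalence.to T-≡ (<⇒<ᵇ x<y)

<ᵇ-false⇒≥ : ∀ {x y} → (x <ᵇ y) ≡ false → y ≤ x
<ᵇ-false⇒≥ eq = ≮⇒≥ λ x<y → contradiction (trans (sym (<⇒<ᵇ-true x<y)) eq) λ ()

∧-true : ∀ {b c} → b ∧ c ≡ true → b ≡ true × c ≡ true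
∧-true {true} {true} _ = refl , refl

not-true : ∀ {b} → not b ≡ true → b ≡ false
not-true {false} _ = refl

sum-mono : ∀ {n} {f g : Fin n → ℕ} → (∀ i → f i ≤ g i) → sum f ≤ sum g
sum-mono {zero}  f≤g = z≤n
sum-mono {suc n} f≤g = f≤g zero ⊕ sum-mono (f≤g ∘ suc)

sum-const : ∀ n c → sum {n} (λ _ → c) ≡ n * c
sum-const zero    c = refl
sum-const (suc n) c = cong (c +_) (sum-const n c)

χ : Bool → ℕ
χ b = if b then 1 else 0

count : ∀ {n} → (Fin n → Bool) → ℕ
count S = sum (χ ∘ S)

sum-scale : ∀ {n} c (f : Fin n → ℕ) → sum (λ i → c * f i) ≡ c * sum f
sum-scale c f = sym (*-distribˡ-sum c f)

count-mono : ∀ {n} (S T : Fin n → Bool) → (∀ i → S i ≡ true → T i ≡ true) → count S ≤ count T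
count-mono S T S⊆T = sum-mono λ i → χ-mono (S i) (T i) (S⊆T i)
  where
  χ-mono : ∀ b c → (b ≡ true → c ≡ true) → χ b ≤ χ c
  χ-mono false c     _ = z≤n
  χ-mono true  true  _ = ≤-refl
  χ-mono true  false h with () ← h refl

count-complement : ∀ {n} (S : Fin n → Bool) → count S + count (not ∘ S) ≡ n
count-complement {n} S = begin
  count S + count (not ∘ S)            ≡⟨ ∑-distrib-+ (χ ∘ S) (χ ∘ not ∘ S) ⟨
  sum (λ i → χ (S i) + χ (not (S i)))  ≡⟨ sum-cong-≗ (λ i → partition (S i)) ⟩
  sum {n} (λ _ → 1)                    ≡⟨ sum-const n 1 ⟩
  n * 1                                ≡⟨ *-identityʳ n ⟩
  n                                    ∎
  where
  open ≡-Reasoning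
  partition : ∀ b → χ b + χ (not b) ≡ 1
  partition false = refl
  partition true  = refl

count-disjoint : ∀ {n} (S T : Fin n → Bool) → (∀ i → S i ≡ true → T i ≡ true → ⊥) →
  count S + count T ≤ n
count-disjoint {n} S T disjoint = begin
  count S + count T              ≡⟨ ∑-distrib-+ (χ ∘ S) (χ ∘ T) ⟨
  sum (λ i → χ (S i) + χ (T i))  ≤⟨ sum-mono (λ i → χ-disjoint (S i) (T i) (disjoint i)) ⟩
  sum {n} (λ _ → 1)              ≡⟨ sum-const n 1 ⟩
  n * 1                          ≡⟨ *-identityʳ n ⟩
  n                              ∎
  where
  open ≤-Reasoning
  χ-disjoint : ∀ b c → (b ≡ true → c ≡ true → ⊥) → χ b + χ c ≤ 1
  χ-disjoint false false _ = z≤n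
  χ-disjoint false true  _ = ≤-refl
  χ-disjoint true  false _ = ≤-refl
  χ-disjoint true  true  h = ⊥-elim (h refl refl)

-- E-large is stated for every multiplier because Agda would unfold the literal multiple
-- 300000 * a when it normalises this telescope.
module MinimumDegree {n : ℕ} (G : Graph n) (a E : ℕ)
  (K₄-free : ∀ p q r s → adj G p q ≡ true → adj G p r ≡ true → adj G p s ≡ true →
             adj G q r ≡ true → adj G q s ≡ true → adj G r s ≡ true → ⊥)
  (edge-in : ∀ (S : Fin n → Bool) → a < count S →
             ∃₂ λ p q → S p ≡ true × S q ≡ true × adj G p q ≡ true)
  (min-degree : ∀ v → n + E ≤ 4 * count (adj G v))
  (a-positive : 1 ≤ a) (E-large : ∀ k → k ≤ 300000 → k * a ≤ E) (n-positive : 1 ≤ n)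
  where

  -- Degrees into a vertex set, controlled by small codegrees.

  8a≤E : 8 * a ≤ E
  8a≤E = E-large 8 (≤ᵇ⇒≤ 8 300000 _)

  infix 4 _~_
  _~_ : Fin n → Fin n → Set
  u ~ v = adj G u v ≡ true

  deg : (Fin n → Bool) → Fin n → ℕ
  deg S u = count (λ i → S i ∧ adj G u i)

  -- More than `a` common neighbours would contain an edge, which completes a K₄ with `u` and `v`.
  codegree≤a : ∀ {u v} → u ~ v → count (λ i → adj G u i ∧ adj G v i) ≤ a
  codegree≤a u~v = ≮⇒≥ λ a<codegree →
    let p , q , p-common , q-common , p~q = edge-in _ a<codegree
        u~p , v~p = ∧-true p-common
        u~q , v~q = ∧-true q-common
    in K₄-free _ _ _ _ u~v u~p u~q v~p v~q p~q

  -- Only common neighbours of `u` and `v` are counted twice on the left.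
  deg-edge : ∀ S {u v} → u ~ v → deg S u + deg S v ≤ count S + a
  deg-edge S {u} {v} u~v = begin
    deg S u + deg S v
      ≡⟨ ∑-distrib-+ {n} _ _ ⟨
    sum (λ i → χ (S i ∧ adj G u i) + χ (S i ∧ adj G v i))
      ≤⟨ sum-mono (λ i → pointwise (S i) (adj G u i) (adj G v i)) ⟩
    sum (λ i → χ (S i) + χ (adj G u i ∧ adj G v i))
      ≡⟨ ∑-distrib-+ {n} _ _ ⟩
    count S + count (λ i → adj G u i ∧ adj G v i)
      ≤⟨ +-monoʳ-≤ (count S) (codegree≤a u~v) ⟩
    count S + a ∎
    where
    open ≤-Reasoning
    pointwise : ∀ s b c → χ (s ∧ b) + χ (s ∧ c) ≤ χ s + χ (b ∧ c)
    pointwise false b     c     = z≤n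
    pointwise true  false false = z≤n
    pointwise true  false true  = ≤-refl
    pointwise true  true  false = ≤-refl
    pointwise true  true  true  = ≤-refl

  -- A vertex of `S` adjacent to j corners counts j on the left and 1 + j(j - 1)/2 ≥ j on the right,
  -- where each pair of corners has at most `a` common neighbours.
  deg-triangle : ∀ S {u v w} → u ~ v → u ~ w → v ~ w →
    deg S u + deg S v + deg S w ≤ count S + 3 * a
  deg-triangle S {u} {v} {w} u~v u~w v~w = begin
    deg S u + deg S v + deg S w
      ≡⟨ cong (_+ deg S w) (∑-distrib-+ {n} _ _) ⟨
    sum (λ i → χ (S i ∧ adj G u i) + χ (S i ∧ adj G v i)) + deg S w
      ≡⟨ ∑-distrib-+ {n} _ _ ⟨
    sum (λ i → χ (S i ∧ adj G u i) + χ (S i ∧ adj G v i) + χ (S i ∧ adj G w i))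
      ≤⟨ sum-mono (λ i → pointwise (S i) (adj G u i) (adj G v i) (adj G w i)) ⟩
    sum (λ i → χ (S i) + (χ (adj G u i ∧ adj G v i) +
                          (χ (adj G u i ∧ adj G w i) + χ (adj G v i ∧ adj G w i))))
      ≡⟨ ∑-distrib-+ {n} _ _ ⟩
    count S + sum (λ i → χ (adj G u i ∧ adj G v i) +
                         (χ (adj G u i ∧ adj G w i) + χ (adj G v i ∧ adj G w i)))
      ≡⟨ cong (count S +_) (trans (∑-distrib-+ {n} _ _) (cong (uv +_) (∑-distrib-+ {n} _ _))) ⟩
    count S + (uv + (uw + vw))
      ≤⟨ +-monoʳ-≤ (count S) (codegree≤a u~v ⊕ (codegree≤a u~w ⊕ codegree≤a v~w)) ⟩
    count S + (a + (a + a))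
      ≡⟨ cong (λ x → count S + (a + (a + x))) (+-identityʳ a) ⟨
    count S + 3 * a ∎
    where
    open ≤-Reasoning
    uv = count (λ i → adj G u i ∧ adj G v i)
    uw = count (λ i → adj G u i ∧ adj G w i)
    vw = count (λ i → adj G v i ∧ adj G w i)
    pointwise : ∀ s b c d →
      χ (s ∧ b) + χ (s ∧ c) + χ (s ∧ d) ≤ χ s + (χ (b ∧ c) + (χ (b ∧ d) + χ (c ∧ d)))
    pointwise false b     c     d     = z≤n
    pointwise true  false false false = z≤n
    pointwise true  false false true  = ≤-refl
    pointwise true  false true  false = ≤-refl
    pointwise true  false true  true  = ≤-refl
    pointwise true  true  false false = ≤-refl
    pointwise true  true  false true  = ≤-refl
    pointwise true  true  true  false = ≤-refl
    pointwise true  true  true  true  = s≤s (s≤s (s≤s z≤n))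

  -- The first two thresholds are the averages allowed by `deg-edge` and `deg-triangle`, cleared of
  -- denominators. Beyond the third, the neighbourhood in `S` must contain an edge.
  heavy rich reach : (Fin n → Bool) → Fin n → Bool
  heavy S u = (count S + a) <ᵇ (2 * deg S u)
  rich  S u = (count S + 3 * a) <ᵇ (3 * deg S u)
  reach S u = a <ᵇ deg S u

  -- Two adjacent heavy vertices would violate `deg-edge`, so the heavy vertices form an independent
  -- set.
  heavy-small : ∀ S → count (heavy S) ≤ a
  heavy-small S = ≮⇒≥ λ a<heavy →
    let p , q , p-heavy , q-heavy , p~q = edge-in _ a<heavy
    in absurd (count S) (deg S p) (deg S q) (<ᵇ-true⇒< p-heavy) (<ᵇ-true⇒< q-heavy) (deg-edge S p~q)
    where
    absurd : ∀ t x y → t + a < 2 * x → t + a < 2 * y → x + y ≤ t + a → ⊥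
    -- Contradictions are obtained as `1 ≤ 0` from `linear`, whose second argument is the slack left
    -- over.
    absurd t x y hx hy h = 1+n≰n {0}
      (linear 1 1 (hx ⊕ hy ⊕ 2 ⊙ h) (solve (t ∷ x ∷ y ∷ a ∷ [])))

  -- More than `a` rich neighbours of a rich vertex would contain an edge, giving a rich triangle
  -- against `deg-triangle`.
  rich-sparse : ∀ S v → rich S v ≡ true → deg (rich S) v ≤ a
  rich-sparse S v v-rich = ≮⇒≥ λ a<deg →
    let p , q , p∈ , q∈ , p~q = edge-in _ a<deg
        p-rich , v~p = ∧-true p∈
        q-rich , v~q = ∧-true q∈
    in absurd (count S) (deg S v) (deg S p) (deg S q)
         (<ᵇ-true⇒< v-rich) (<ᵇ-true⇒< p-rich) (<ᵇ-true⇒< q-rich) (deg-triangle S v~p v~q p~q)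
    where
    absurd : ∀ t x y z → t + 3 * a < 3 * x → t + 3 * a < 3 * y → t + 3 * a < 3 * z →
      x + y + z ≤ t + 3 * a → ⊥
    absurd t x y z hx hy hz h = 1+n≰n {0}
      (linear 1 2 (hx ⊕ hy ⊕ hz ⊕ 3 ⊙ h) (solve (t ∷ x ∷ y ∷ z ∷ a ∷ [])))

  -- Averaging over degrees and narrowing the reach.

  deg-complement : ∀ S u → deg S u + deg (not ∘ S) u ≡ count (adj G u)
  deg-complement S u = trans (sym (∑-distrib-+ {n} _ _))
    (sum-cong-≗ λ i → pointwise (S i) (adj G u i))
    where
    pointwise : ∀ s b → χ (s ∧ b) + χ (not s ∧ b) ≡ χ b
    pointwise false b = refl
    pointwise true  b = +-identityʳ (χ b)

  -- Double counting of the adjacent pairs with one vertex in `S`.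
  deg-sum-lower : ∀ S → count S * (n + E) ≤ 4 * sum (deg S)
  deg-sum-lower S = begin
    count S * (n + E)                                   ≡⟨ *-comm (count S) (n + E) ⟩
    (n + E) * count S                                   ≡⟨ *-distribˡ-sum (n + E) (χ ∘ S) ⟩
    sum (λ i → (n + E) * χ (S i))                       ≤⟨ sum-mono column ⟩
    sum (λ i → 4 * sum (λ u → χ (S i ∧ adj G u i)))     ≡⟨ *-distribˡ-sum {n} 4 _ ⟨
    4 * sum (λ i → sum (λ u → χ (S i ∧ adj G u i)))     ≡⟨ cong (4 *_) (∑-comm {n} {n} _) ⟩
    4 * sum (deg S)                                     ∎
    where
    open ≤-Reasoning
    column : ∀ i → (n + E) * χ (S i) ≤ 4 * sum (λ u → χ (S i ∧ adj G u i))
    column i with S i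
    ... | false = ≤-trans (≤-reflexive (*-zeroʳ (n + E))) z≤n
    ... | true  = begin
      (n + E) * 1                     ≡⟨ *-identityʳ (n + E) ⟩
      n + E                           ≤⟨ min-degree i ⟩
      4 * count (adj G i)             ≡⟨ cong (4 *_) (sum-cong-≗ λ u → cong χ (adj-sym G i u)) ⟩
      4 * sum (λ u → χ (adj G u i))   ∎

  deg≤count : ∀ S u → deg S u ≤ count S
  deg≤count S u = count-mono _ S λ i i∈ → proj₁ (∧-true i∈)

  -- The average degree into `S` exceeds |S| / 4 by |S| E / (4n) or more. The at most `a` vertices
  -- heavy for `Q` contribute at most a |S| to the degree sum, too little to account for this excess
  -- since E ≥ 8a.
  light-vertex : ∀ S Q → 1 ≤ count S → ∃ λ x → heavy Q x ≡ false × count S < 4 * deg S x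
  light-vertex S Q 1≤t
    with any? (λ x → (heavy Q x Bool.≟ false) ×-dec (count S <? 4 * deg S x))
  ... | yes found = found
  ... | no  none  = ⊥-elim (absurd (count S) (sum (deg S)) (count (heavy Q)) 1≤t
                              (deg-sum-lower S) degree-sum (heavy-small Q))
    where
    t = count S
    pointwise : ∀ x → 4 * deg S x ≤ t + 4 * t * χ (heavy Q x)
    pointwise x with heavy Q x in eq
    ... | true  = ≤-trans (4 ⊙ deg≤count S x) (≤-trans (≤-reflexive (sym (*-identityʳ (4 * t)))) (m≤n+m _ t))
    ... | false = ≤-trans (≮⇒≥ λ t<4d → none (x , eq , t<4d)) (m≤m+n t _)
    degree-sum : 4 * sum (deg S) ≤ n * t + 4 * t * count (heavy Q)
    degree-sum = begin
      4 * sum (deg S)                               ≡⟨ sum-scale 4 (deg S) ⟨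
      sum (λ x → 4 * deg S x)                       ≤⟨ sum-mono pointwise ⟩
      sum (λ x → t + 4 * t * χ (heavy Q x))         ≡⟨ ∑-distrib-+ {n} _ _ ⟩
      sum {n} (λ _ → t) + sum (λ x → 4 * t * χ (heavy Q x))
        ≡⟨ cong₂ _+_ (sum-const n t) (sum-scale (4 * t) (χ ∘ heavy Q)) ⟩
      n * t + 4 * t * count (heavy Q)               ∎
      where open ≤-Reasoning
    absurd : ∀ t s h → 1 ≤ t → t * (n + E) ≤ 4 * s → 4 * s ≤ n * t + 4 * t * h → h ≤ a → ⊥
    absurd t s h 1≤t l u h≤a = 1+n≰n {0} (linear 1 (3 * a)
      (*-cancelˡ-≤ t {{>-nonZero 1≤t}} cancelled ⊕ 8a≤E ⊕ a-positive) (solve (n ∷ a ∷ E ∷ [])))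
      where
      cancelled : t * (n + E) ≤ t * (n + 4 * a)
      cancelled = linear 1 0 (l ⊕ u ⊕ (4 * t) ⊙ h≤a) (solve (t ∷ s ∷ h ∷ n ∷ a ∷ E ∷ []))

  -- Passing to S′ = S ∩ N(x) removes N(x) from the reach, since an edge has codegree at most a.
  -- As x is not heavy for the complement of the reach, it has many neighbours inside the reach, and
  -- the excess of |reach S| over n / 2 is halved; |S| drops only by a factor 4.
  refine : ∀ S → 1 ≤ count S → ∃ λ S′ →
    count S ≤ 4 * count S′ × 4 * count (reach S′) ≤ 2 * count (reach S) + n
  refine S 1≤t = S′ , <⇒≤ t<4d ,
    arithmetic (count P) (count P′) (count (not ∘ P)) (count (adj G x)) (deg P x) (deg (not ∘ P) x)
      (count-complement P) (deg-complement P x) (min-degree x) (<ᵇ-false⇒≥ x-light) P′-small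
    where
    P = reach S
    vertex = light-vertex S (not ∘ P) 1≤t
    x = proj₁ vertex
    x-light = proj₁ (proj₂ vertex)
    t<4d = proj₂ (proj₂ vertex)
    S′ : Fin n → Bool
    S′ i = S i ∧ adj G x i
    P′ = reach S′
    pointwise : ∀ i → χ (P′ i) + χ (P i ∧ adj G x i) ≤ χ (P i)
    pointwise i with P′ i in reached | P i in reachable | adj G x i in x~i
    ... | false | false | _     = z≤n
    ... | false | true  | false = z≤n
    ... | false | true  | true  = ≤-refl
    ... | true  | true  | false = ≤-refl
    ... | true  | true  | true  = contradiction (≤-trans deg≤codegree (codegree≤a x~i))
                                                (<⇒≱ (<ᵇ-true⇒< reached))
      where
      deg≤codegree : deg S′ i ≤ count (λ j → adj G x j ∧ adj G i j)
      deg≤codegree = count-mono _ _ λ j j∈ →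
        let j∈S′ , i~j = ∧-true {S′ j} j∈ in cong₂ _∧_ (proj₂ (∧-true {S j} j∈S′)) i~j
    ... | true  | false | _     = contradiction (≤-trans deg-anti (<ᵇ-false⇒≥ reachable))
                                                (<⇒≱ (<ᵇ-true⇒< reached))
      where
      deg-anti : deg S′ i ≤ deg S i
      deg-anti = count-mono _ _ λ j j∈ →
        let j∈S′ , i~j = ∧-true {S′ j} j∈ in cong₂ _∧_ (proj₁ (∧-true {S j} j∈S′)) i~j
    P′-small : count P′ + deg P x ≤ count P
    P′-small = ≤-trans (≤-reflexive (sym (∑-distrib-+ {n} _ _))) (sum-mono pointwise)
    -- At most (q + a) / 2 neighbours of `x` lie outside `P`, hence at least (n + E) / 4 - (q + a) /
    -- 2 lie inside and leave the reach; here q = n - p, and E outweighs 2a.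
    arithmetic : ∀ p p′ q d dp dq → p + q ≡ n → dp + dq ≡ d → n + E ≤ 4 * d →
      2 * dq ≤ q + a → p′ + dp ≤ p → 4 * p′ ≤ 2 * p + n
    arithmetic p p′ q d dp dq refl refl hd hq hp = linear 1 (6 * a)
      (hd ⊕ 2 ⊙ hq ⊕ 4 ⊙ hp ⊕ 8a≤E) (solve (p ∷ p′ ∷ q ∷ dp ∷ dq ∷ E ∷ a ∷ []))

  nonempty : ∀ c t → n ≤ c * t → 1 ≤ t
  nonempty c zero    n≤0 = contradiction (≤-trans n-positive (≤-trans n≤0 (≤-reflexive (*-zeroʳ c)))) λ ()
  nonempty c (suc t) _   = s≤s z≤n

  -- The bound on |reach S| is n / 2 + n / 2^(k + 1). It is trivial for k = 0, and each use of
  -- `refine` halves the excess at the price of a factor 4 in |S|.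
  narrow : ∀ k → ∃ λ S → n ≤ 4 ^ k * count S × 2 ^ suc k * count (reach S) ≤ (2 ^ k + 1) * n
  narrow zero = (λ _ → true) ,
    ≤-reflexive (sym (trans (*-identityˡ _) everything)) ,
    *-monoʳ-≤ 2 (≤-trans (count-mono (reach (λ _ → true)) (λ _ → true) λ _ _ → refl)
                         (≤-reflexive everything))
    where
    everything : count {n} (λ _ → true) ≡ n
    everything = trans (sum-const n 1) (*-identityʳ n)
  narrow (suc k) with narrow k
  ... | S , n≤ , reach≤ with refine S (nonempty (4 ^ k) (count S) n≤)
  ... | S′ , t≤4t′ , P′≤ = S′ ,
    size (4 ^ k) (count S) (count S′) n≤ t≤4t′ ,
    spread (2 ^ k) (count (reach S)) (count (reach S′)) reach≤ P′≤
    where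
    size : ∀ c t t′ → n ≤ c * t → t ≤ 4 * t′ → n ≤ 4 * c * t′
    size c t t′ h₁ h₂ = linear 1 0 (h₁ ⊕ c ⊙ h₂) (solve (n ∷ c ∷ t ∷ t′ ∷ []))
    spread : ∀ c p p′ → 2 * c * p ≤ (c + 1) * n → 4 * p′ ≤ 2 * p + n →
      2 * (2 * c) * p′ ≤ (2 * c + 1) * n
    spread c p p′ h₁ h₂ = linear 1 0 (h₁ ⊕ c ⊙ h₂) (solve (n ∷ c ∷ p ∷ p′ ∷ []))

  -- Up to error terms in `a`, a vertex sees nothing of `S` if unreached, a third if reached but
  -- poor, and half if rich but not heavy; few are heavy. Comparison with the average degree |S| / 4
  -- gives the bound. The total error 12(c + 1)a is absorbed by 3E, which is what `c-small` ensures.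
  reach-or-rich : ∀ c S → 4 * (c + 1) ≤ 300000 → n ≤ c * count S →
    3 * n ≤ 4 * count (reach S) + 2 * count (rich S)
  reach-or-rich c S c-small n≤ct =
    arithmetic t (count (heavy S)) (count (reach S)) (count (rich S)) (sum (deg S))
      n≤ct (deg-sum-lower S) degree-sum (heavy-small S)
    where
    t = count S
    pointwise : ∀ u → 6 * deg S u ≤ 6 * a + (6 * t * χ (heavy S u) + (2 * t * χ (reach S u) + t * χ (rich S u)))
    pointwise u = cases t (deg S u) (heavy S u) (reach S u) (rich S u)
      (deg≤count S u) <ᵇ-false⇒≥ <ᵇ-false⇒≥ <ᵇ-false⇒≥
      where
      cases : ∀ t d h p r → d ≤ t → (h ≡ false → 2 * d ≤ t + a) → (p ≡ false → d ≤ a) →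
        (r ≡ false → 3 * d ≤ t + 3 * a) →
        6 * d ≤ 6 * a + (6 * t * χ h + (2 * t * χ p + t * χ r))
      cases t d true p r d≤t _ _ _ = trivially (2 * t * χ p + t * χ r)
        where
        trivially : ∀ x → 6 * d ≤ 6 * a + (6 * t * 1 + x)
        trivially x = linear 1 (6 * a + x) (6 ⊙ d≤t) (solve (t ∷ d ∷ a ∷ x ∷ []))
      cases t d false false r _ _ unreached _ = ≤-trans (*-monoʳ-≤ 6 (unreached refl)) (m≤m+n (6 * a) _)
      cases t d false true false _ _ _ poor = linear 1 0 (2 ⊙ poor refl) (solve (t ∷ d ∷ a ∷ []))
      cases t d false true true _ light _ _ = linear 1 (3 * a) (3 ⊙ light refl) (solve (t ∷ d ∷ a ∷ []))
    degree-sum : 6 * sum (deg S) ≤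
      n * (6 * a) + (6 * t * count (heavy S) + (2 * t * count (reach S) + t * count (rich S)))
    degree-sum = begin
      6 * sum (deg S)
        ≡⟨ sum-scale 6 (deg S) ⟨
      sum (λ u → 6 * deg S u)
        ≤⟨ sum-mono pointwise ⟩
      sum (λ u → 6 * a + (6 * t * χ (heavy S u) + (2 * t * χ (reach S u) + t * χ (rich S u))))
        ≡⟨ trans (∑-distrib-+ {n} _ _) (cong (sum {n} (λ _ → 6 * a) +_)
             (trans (∑-distrib-+ {n} _ _) (cong (sum (λ u → 6 * t * χ (heavy S u)) +_) (∑-distrib-+ {n} _ _)))) ⟩
      sum {n} (λ _ → 6 * a) + (sum (λ u → 6 * t * χ (heavy S u)) +
        (sum (λ u → 2 * t * χ (reach S u)) + sum (λ u → t * χ (rich S u))))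
        ≡⟨ cong₂ _+_ (sum-const n (6 * a)) (cong₂ _+_ (sum-scale (6 * t) (χ ∘ heavy S))
             (cong₂ _+_ (sum-scale (2 * t) (χ ∘ reach S)) (sum-scale t (χ ∘ rich S)))) ⟩
      n * (6 * a) + (6 * t * count (heavy S) + (2 * t * count (reach S) + t * count (rich S))) ∎
      where open ≤-Reasoning
    arithmetic : ∀ t h p r s → n ≤ c * t → t * (n + E) ≤ 4 * s →
      6 * s ≤ n * (6 * a) + (6 * t * h + (2 * t * p + t * r)) → h ≤ a → 3 * n ≤ 4 * p + 2 * r
    arithmetic t h p r s n≤ct lower upper h≤a = linear 2 0
      (*-cancelˡ-≤ t {{>-nonZero (nonempty c t n≤ct)}} cancelled ⊕ 6 ⊙ E-large (4 * (c + 1)) c-small)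
      (solve (c ∷ n ∷ a ∷ E ∷ p ∷ r ∷ []))
      where
      cancelled : t * (6 * (n + E)) ≤ t * (24 * c * a + 24 * a + 8 * p + 4 * r)
      cancelled = linear 1 0 (6 ⊙ lower ⊕ 4 ⊙ upper ⊕ (24 * t) ⊙ h≤a ⊕ (24 * a) ⊙ n≤ct)
        (solve (c ∷ t ∷ n ∷ a ∷ E ∷ h ∷ p ∷ r ∷ s ∷ []))

  -- The partition into two sparse sets and the final contradiction.

  -- Degrees are at most n, so E ≤ 3n, while E ≥ 300a.
  100a≤n : 100 * a ≤ n
  100a≤n = arithmetic (count (adj G v)) (min-degree v)
    (≤-trans (m≤m+n _ _) (≤-reflexive (count-complement (adj G v))))
    where
    v = fromℕ< n-positive
    arithmetic : ∀ d → n + E ≤ 4 * d → d ≤ n → 100 * a ≤ n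
    arithmetic d hd d≤n = linear 3 0 (E-large 300 (≤ᵇ⇒≤ 300 300000 _) ⊕ hd ⊕ 4 ⊙ d≤n)
      (solve (a ∷ n ∷ E ∷ d ∷ []))

  -- This makes a sparse set disjoint from its set of rich vertices.
  sparse-poor : ∀ S v → deg S v ≤ a → rich S v ≡ true → ⊥
  sparse-poor S v deg≤a v-rich = absurd (count S) (deg S v) (<ᵇ-true⇒< v-rich) deg≤a
    where
    absurd : ∀ t d → t + 3 * a < 3 * d → d ≤ a → ⊥
    absurd t d h d≤a = 1+n≰n {0} (linear 1 t (h ⊕ 3 ⊙ d≤a) (solve (t ∷ d ∷ a ∷ [])))

  -- A sparse X with almost n / 2 vertices forces Y = rich X to be about as large; the triangle
  -- bound then places every remaining vertex in Z = rich Y, so that Y and Z are sparse and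
  -- partition the graph.
  module Bipartition (X : Fin n → Bool) (X-sparse : ∀ v → X v ≡ true → deg X v ≤ a)
    (X-large : 127 * n ≤ 256 * count X) where

    Y Z : Fin n → Bool
    Y = rich X
    Z = rich Y

    X+Y≤n : count X + count Y ≤ n
    X+Y≤n = count-disjoint X Y λ v v∈X → sparse-poor X v (X-sparse v v∈X)

    -- Vertices of `X` are not reached from `X`, so the reach has at most 129n / 256 vertices. The
    -- multiplier 3 is available because 127 / 256 > 1 / 3.
    Y-large : 63 * n ≤ 128 * count Y
    Y-large = arithmetic (count X) (count (reach X)) (count Y) X-large
      (count-disjoint (reach X) X λ v reached v∈X → <⇒≱ (<ᵇ-true⇒< reached) (X-sparse v v∈X))
      (reach-or-rich 3 X (≤ᵇ⇒≤ 16 300000 _) (n≤3x (count X) X-large))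
      where
      n≤3x : ∀ x → 127 * n ≤ 256 * x → n ≤ 3 * x
      n≤3x x h = linear 127 (125 * x) h (solve (n ∷ x ∷ []))
      arithmetic : ∀ x p y → 127 * n ≤ 256 * x → p + x ≤ n → 3 * n ≤ 4 * p + 2 * y →
        63 * n ≤ 128 * y
      arithmetic x p y hx hp hy = linear 1 0 (hx ⊕ 256 ⊙ hp ⊕ 64 ⊙ hy)
        (solve (n ∷ x ∷ p ∷ y ∷ []))

    -- The disjoint sets `X` and `Y` miss at most 3n / 256 vertices, and a degree is at least (64n +
    -- 64E) / 256.
    deg-X+Y : ∀ u → 61 * n + 64 * E ≤ 256 * (deg X u + deg Y u)
    deg-X+Y u = arithmetic (count X) (count Y) (count (adj G u)) (deg X u) (deg Y u)
      X-large Y-large (min-degree u) inclusion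
      where
      inclusion : count (adj G u) + (count X + count Y) ≤ deg X u + (deg Y u + n)
      inclusion = begin
        count (adj G u) + (count X + count Y)
          ≡⟨ trans (cong (count (adj G u) +_) (sym (∑-distrib-+ {n} _ _))) (sym (∑-distrib-+ {n} _ _)) ⟩
        sum (λ i → χ (adj G u i) + (χ (X i) + χ (Y i)))
          ≤⟨ sum-mono (λ i → pointwise (adj G u i) (X i) (Y i)
               λ i∈X → sparse-poor X i (X-sparse i i∈X)) ⟩
        sum (λ i → χ (X i ∧ adj G u i) + (χ (Y i ∧ adj G u i) + 1))
          ≡⟨ trans (∑-distrib-+ {n} _ _) (cong (deg X u +_) (trans (∑-distrib-+ {n} _ _)
               (cong (deg Y u +_) (trans (sum-const n 1) (*-identityʳ n))))) ⟩
        deg X u + (deg Y u + n) ∎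
        where
        open ≤-Reasoning
        pointwise : ∀ b x y → (x ≡ true → y ≡ true → ⊥) →
          χ b + (χ x + χ y) ≤ χ (x ∧ b) + (χ (y ∧ b) + 1)
        pointwise false false false _ = z≤n
        pointwise false false true  _ = ≤-refl
        pointwise false true  false _ = ≤-refl
        pointwise true  false false _ = ≤-refl
        pointwise true  false true  _ = ≤-refl
        pointwise true  true  false _ = ≤-refl
        pointwise b     true  true  h = ⊥-elim (h refl refl)
      arithmetic : ∀ x y d dx dy → 127 * n ≤ 256 * x → 63 * n ≤ 128 * y → n + E ≤ 4 * d →
        d + (x + y) ≤ dx + (dy + n) → 61 * n + 64 * E ≤ 256 * (dx + dy)
      arithmetic x y d dx dy hx hy hd h = linear 1 0 (hx ⊕ 2 ⊙ hy ⊕ 64 ⊙ hd ⊕ 256 ⊙ h)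
        (solve (n ∷ E ∷ x ∷ y ∷ d ∷ dx ∷ dy ∷ []))

    deg-other : ∀ dx dy → 61 * n + 64 * E ≤ 256 * (dx + dy) → dx ≤ a → 61 * n ≤ 256 * dy
    deg-other dx dy h dx≤a = linear 1 (256 * a) (h ⊕ 256 ⊙ dx≤a ⊕ 64 ⊙ 8a≤E)
      (solve (n ∷ E ∷ a ∷ dx ∷ dy ∷ []))

    deg-Y : ∀ u → deg X u ≤ a → 61 * n ≤ 256 * deg Y u
    deg-Y u = deg-other (deg X u) (deg Y u) (deg-X+Y u)

    deg-X : ∀ u → deg Y u ≤ a → 61 * n ≤ 256 * deg X u
    deg-X u = deg-other (deg Y u) (deg X u)
      (subst (λ d → 61 * n + 64 * E ≤ 256 * d) (+-comm (deg X u) (deg Y u)) (deg-X+Y u))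

    -- The neighbours of `u` in `S` contain an edge pq. In the triangle upq, `deg-triangle` leaves
    -- to `u` only what p and q do not take of `W`.
    deg-across : ∀ S W → (∀ p → S p ≡ true → 61 * n ≤ 256 * deg W p) → ∀ u → a < deg S u →
      256 * deg W u + 122 * n ≤ 256 * count W + 768 * a
    deg-across S W S→W u a<deg =
      let p , q , p∈ , q∈ , p~q = edge-in _ a<deg
          p∈S , u~p = ∧-true p∈
          q∈S , u~q = ∧-true q∈
      in arithmetic (count W) (deg W u) (deg W p) (deg W q)
           (S→W p p∈S) (S→W q q∈S) (deg-triangle W u~p u~q p~q)
      where
      arithmetic : ∀ w x y z → 61 * n ≤ 256 * y → 61 * n ≤ 256 * z → x + y + z ≤ w + 3 * a →
        256 * x + 122 * n ≤ 256 * w + 768 * a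
      arithmetic w x y z hy hz h = linear 1 0 (hy ⊕ hz ⊕ 256 ⊙ h)
        (solve (n ∷ a ∷ w ∷ x ∷ y ∷ z ∷ []))

    -- Otherwise `deg-across` in both directions bounds the degree into `X` and `Y` together by 12n
    -- / 256 + 6a, against 61n / 256 + E / 4.
    one-sided : ∀ u → a < deg X u → a < deg Y u → ⊥
    one-sided u a<dX a<dY = absurd (count X) (count Y) (deg X u) (deg Y u) X+Y≤n (deg-X+Y u)
      (deg-across Y X (λ p p∈Y → deg-X p (rich-sparse X p p∈Y)) u a<dY)
      (deg-across X Y (λ p p∈X → deg-Y p (X-sparse p p∈X)) u a<dX)
      where
      absurd : ∀ x y dx dy → x + y ≤ n → 61 * n + 64 * E ≤ 256 * (dx + dy) →
        256 * dx + 122 * n ≤ 256 * x + 768 * a → 256 * dy + 122 * n ≤ 256 * y + 768 * a → ⊥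
      absurd x y dx dy h hd hx hy = 1+n≰n {0} (linear 1 (48 * n)
        (256 ⊙ h ⊕ hd ⊕ hx ⊕ hy ⊕ 64 ⊙ E-large 24 (≤ᵇ⇒≤ 24 300000 _) ⊕ n-positive)
        (solve (n ∷ a ∷ E ∷ x ∷ y ∷ dx ∷ dy ∷ [])))

    -- By `one-sided`, `u` has few neighbours in `X` or in `Y`, hence at least 61n / 256 in the
    -- other set. That set has at most 130n / 256 vertices and 3 · 61 = 183 > 130, so `u` is rich
    -- for it: it lies in `Z` in the first case and in `Y` in the second.
    cover : ∀ u → Y u ≡ false → Z u ≡ true
    cover u u∉Y with deg X u ≤? a
    ... | yes dX≤a = <⇒<ᵇ-true (arithmetic (count X) (count Y) (deg Y u) X-large X+Y≤n (deg-Y u dX≤a))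
      where
      arithmetic : ∀ x y d → 127 * n ≤ 256 * x → x + y ≤ n → 61 * n ≤ 256 * d → y + 3 * a < 3 * d
      arithmetic x y d hx h hd = linear 256 (43 * n + 76 * a)
        (hx ⊕ 256 ⊙ h ⊕ 3 ⊙ hd ⊕ 11 ⊙ 100a≤n ⊕ 256 ⊙ a-positive)
        (solve (n ∷ a ∷ x ∷ y ∷ d ∷ []))
    ... | no dX≰a = ⊥-elim (absurd (count X) (count Y) (deg X u) Y-large X+Y≤n
                      (deg-X u (≮⇒≥ (one-sided u (≰⇒> dX≰a)))) (<ᵇ-false⇒≥ u∉Y))
      where
      absurd : ∀ x y d → 63 * n ≤ 128 * y → x + y ≤ n → 61 * n ≤ 256 * d → 3 * d ≤ x + 3 * a → ⊥
      absurd x y d hy h hd hx = 1+n≰n {0} (linear 1 (44 * n + 32 * a)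
        (2 ⊙ hy ⊕ 256 ⊙ h ⊕ 3 ⊙ hd ⊕ 256 ⊙ hx ⊕ 8 ⊙ 100a≤n ⊕ n-positive)
        (solve (n ∷ a ∷ x ∷ y ∷ d ∷ [])))

    deg-¬Y≤deg-Z : ∀ u → deg (not ∘ Y) u ≤ deg Z u
    deg-¬Y≤deg-Z u = count-mono _ _ λ i i∈ →
      let i∉Y , u~i = ∧-true {not (Y i)} i∈ in cong₂ _∧_ (cover i (not-true i∉Y)) u~i

    min-degree-split : ∀ u → n + E ≤ 4 * (deg Y u + deg Z u)
    min-degree-split u = ≤-trans (min-degree u) (*-monoʳ-≤ 4 (≤-trans
      (≤-reflexive (sym (deg-complement Y u))) (+-monoʳ-≤ (deg Y u) (deg-¬Y≤deg-Z u))))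

    Z-large : 127 * n ≤ 256 * count Z
    Z-large = arithmetic (count X) (count Y) (count (not ∘ Y)) (count Z)
      X-large X+Y≤n (count-complement Y) (count-mono _ _ λ i i∉Y → cover i (not-true i∉Y))
      where
      arithmetic : ∀ x y y′ z → 127 * n ≤ 256 * x → x + y ≤ n → y + y′ ≡ n → y′ ≤ z →
        127 * n ≤ 256 * z
      arithmetic x y y′ z hx h eq hz = linear 1 0
        (hx ⊕ 256 ⊙ h ⊕ 256 ⊙ ≤-reflexive (sym eq) ⊕ 256 ⊙ hz)
        (solve (n ∷ x ∷ y ∷ y′ ∷ z ∷ []))

    inconsistent : ⊥
    inconsistent =
      let p , q , p∈Y , q∈Y , p~q = edge-in Y (a<y (count Y) Y-large)
          r , s , r∈Z , s∈Z , r~s = edge-in Z (a<z (count Z) Z-large)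
      in absurd (count Y) (count Z) (deg Y p) (deg Z p) (deg Y q) (deg Z q)
           (deg Y r) (deg Z r) (deg Y s) (deg Z s)
           (min-degree-split p) (min-degree-split q) (min-degree-split r) (min-degree-split s)
           (rich-sparse X p p∈Y) (rich-sparse X q q∈Y) (rich-sparse Y r r∈Z) (rich-sparse Y s s∈Z)
           (deg-edge Z p~q) (deg-edge Y r~s)
           (count-disjoint Y Z λ v v∈Y → sparse-poor Y v (rich-sparse X v v∈Y))
      where
      a<y : ∀ y → 63 * n ≤ 128 * y → a < y
      a<y y h = linear 128 (6044 * a) (h ⊕ 63 ⊙ 100a≤n ⊕ 128 ⊙ a-positive) (solve (n ∷ a ∷ y ∷ []))
      a<z : ∀ z → 127 * n ≤ 256 * z → a < z
      a<z z h = linear 256 (12188 * a) (h ⊕ 127 ⊙ 100a≤n ⊕ 256 ⊙ a-positive) (solve (n ∷ a ∷ z ∷ []))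
      -- The four degrees sum to at most |Y| + |Z| + 6a ≤ n + 6a, but to at least n + E ≥ n + 8a.
      absurd : ∀ y z yp zp yq zq yr zr ys zs →
        n + E ≤ 4 * (yp + zp) → n + E ≤ 4 * (yq + zq) → n + E ≤ 4 * (yr + zr) → n + E ≤ 4 * (ys + zs) →
        yp ≤ a → yq ≤ a → zr ≤ a → zs ≤ a → zp + zq ≤ z + a → yr + ys ≤ y + a → y + z ≤ n → ⊥
      absurd y z yp zp yq zq yr zr ys zs hp hq hr hs yp≤a yq≤a zr≤a zs≤a hz hy h = 1+n≰n {0}
        (linear 1 (7 * a) (hp ⊕ hq ⊕ hr ⊕ hs ⊕ 4 ⊙ yp≤a ⊕ 4 ⊙ yq≤a ⊕ 4 ⊙ zr≤a ⊕ 4 ⊙ zs≤a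
                     ⊕ 4 ⊙ hz ⊕ 4 ⊙ hy ⊕ 4 ⊙ h ⊕ 4 ⊙ 8a≤E ⊕ a-positive)
          (solve (n ∷ a ∷ E ∷ y ∷ z ∷ yp ∷ zp ∷ yq ∷ zq ∷ yr ∷ zr ∷ ys ∷ zs ∷ [])))

  inconsistent : ⊥
  inconsistent =
    -- Eight rounds bring the reach down to 257n / 512, which leaves at least 127n / 256 rich
    -- vertices. The multiplier is then 4^8, and 4(4^8 + 1) = 262148 accounts for the bound 300000.
    let S , n≤ , reach≤ = narrow 8
    in Bipartition.inconsistent (rich S) (rich-sparse S)
         (arithmetic (2 ^ 8) (count (reach S)) (count (rich S)) refl reach≤
           (reach-or-rich (4 ^ 8) S (≤ᵇ⇒≤ (4 * (4 ^ 8 + 1)) 300000 _) n≤))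
    where
    arithmetic : ∀ m p r → m ≡ 256 → 2 * m * p ≤ (m + 1) * n → 3 * n ≤ 4 * p + 2 * r →
      127 * n ≤ 256 * r
    arithmetic .256 p r refl hp hr = linear 1 0 (hp ⊕ 128 ⊙ hr) (solve (n ∷ p ∷ r ∷ []))

-- Exhaustive search for an independent set or a K₄.

enumerate : ∀ {n} k (S : Fin n → Bool) → k ≤ count S →
  ∃ λ (f : Fin k → Fin n) → Injective _≡_ _≡_ f × (∀ i → S (f i) ≡ true)
enumerate         zero    S _  = (λ ()) , (λ { {()} }) , λ ()
enumerate {zero}  (suc k) S ()
enumerate {suc n} (suc k) S with S zero in 0∈S
... | false = λ k<count →
  let f , f-injective , f∈S = enumerate (suc k) (S ∘ suc) k<count
  in suc ∘ f , f-injective ∘ Fin.suc-injective , f∈S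
... | true = λ k<count →
  let f , f-injective , f∈S = enumerate k (S ∘ suc) (s≤s⁻¹ k<count)
  in (λ { zero → zero ; (suc i) → suc (f i) })
   , (λ { {zero} {zero} _ → refl
        ; {suc i} {suc j} eq → cong suc (f-injective (Fin.suc-injective eq)) })
   , λ { zero → 0∈S ; (suc i) → f∈S i }

module _ {n} (G : Graph n) where

  Independent : (Fin n → Bool) → Set
  Independent S = ∀ p q → S p ≡ true → S q ≡ true → adj G p q ≡ false

  independent⇒HasIndependentSet : ∀ {k} S → k ≤ count S → Independent S → HasIndependentSet G k
  independent⇒HasIndependentSet S k≤count S-independent =
    let f , f-injective , f∈S = enumerate _ S k≤count
    in f , f-injective , λ i j _ → S-independent (f i) (f j) (f∈S i) (f∈S j)

  independent-set? : ∀ a → HasIndependentSet G (suc a) ⊎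
    (∀ S → a < count S → ∃₂ λ p q → S p ≡ true × S q ≡ true × adj G p q ≡ true)
  independent-set? a with anySubset? {n = n} {P = λ s → a < count (lookup s) × Independent (lookup s)}
    (λ s → (a <? count (lookup s)) ×-dec all? λ p → all? λ q →
      (lookup s p Bool.≟ true) →-dec ((lookup s q Bool.≟ true) →-dec (adj G p q Bool.≟ false)))
  ... | yes (s , a<count , s-independent) =
    inj₁ (independent⇒HasIndependentSet (lookup s) a<count s-independent)
  ... | no none = inj₂ λ S a<count → edge S a<count
    (any? λ p → any? λ q → (S p Bool.≟ true) ×-dec ((S q Bool.≟ true) ×-dec (adj G p q Bool.≟ true)))
    where
    edge : ∀ S → a < count S → Dec (∃₂ λ p q → S p ≡ true × S q ≡ true × adj G p q ≡ true) →
      ∃₂ λ p q → S p ≡ true × S q ≡ true × adj G p q ≡ true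
    edge S a<count (yes found) = found
    -- The search runs over bit vectors, so `S` is replaced by `tabulate S`, which agrees with it
    -- pointwise.
    edge S a<count (no ¬edge) = contradiction
      (tabulate S , subst (a <_) (sym (sum-cong-≗ λ i → cong χ (lookup∘tabulate S i))) a<count ,
        λ p q p∈S q∈S → non-adjacent p q (trans (sym (lookup∘tabulate S p)) p∈S)
                                          (trans (sym (lookup∘tabulate S q)) q∈S))
      none
      where
      non-adjacent : Independent S
      non-adjacent p q p∈S q∈S with adj G p q in p~q
      ... | false = refl
      ... | true  = contradiction (p , q , p∈S , q∈S , p~q) ¬edge

  -- Injectivity comes from irreflexivity: equal images of distinct indices would give a loop.
  clique : ∀ {k} (f : Fin k → Fin n) → (∀ i j → i ≢ j → adj G (f i) (f j) ≡ true) → HasClique G k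
  clique f f-adjacent = f , f-injective , f-adjacent
    where
    f-injective : Injective _≡_ _≡_ f
    f-injective {i} {j} fi≡fj with i Fin.≟ j
    ... | yes i≡j = i≡j
    ... | no  i≢j = contradiction
      (trans (sym (f-adjacent i j i≢j)) (trans (cong (adj G (f i)) (sym fi≡fj)) (irrefl G (f i)))) λ ()

  K₄-free : Set
  K₄-free = ∀ p q r s → adj G p q ≡ true → adj G p r ≡ true → adj G p s ≡ true →
    adj G q r ≡ true → adj G q s ≡ true → adj G r s ≡ true → ⊥

  K₄? : HasClique G 4 ⊎ K₄-free
  K₄? with any? (λ p → any? λ q → any? λ r → any? λ s →
    (adj G p q Bool.≟ true) ×-dec (adj G p r Bool.≟ true) ×-dec (adj G p s Bool.≟ true) ×-dec
    (adj G q r Bool.≟ true) ×-dec (adj G q s Bool.≟ true) ×-dec (adj G r s Bool.≟ true))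
  ... | no none = inj₂ λ p q r s pq pr ps qr qs rs → none (p , q , r , s , pq , pr , ps , qr , qs , rs)
  ... | yes (p , q , r , s , pq , pr , ps , qr , qs , rs) = inj₁ (clique f f-adjacent)
    where
    f : Fin 4 → Fin n
    f 0F = p
    f 1F = q
    f 2F = r
    f 3F = s
    flip-adj : ∀ {u v} → adj G u v ≡ true → adj G v u ≡ true
    flip-adj {u} {v} = trans (adj-sym G v u)
    f-adjacent : ∀ i j → i ≢ j → adj G (f i) (f j) ≡ true
    f-adjacent 0F 0F i≢j = contradiction refl i≢j
    f-adjacent 0F 1F _   = pq
    f-adjacent 0F 2F _   = pr
    f-adjacent 0F 3F _   = ps
    f-adjacent 1F 0F _   = flip-adj pq
    f-adjacent 1F 1F i≢j = contradiction refl i≢j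
    f-adjacent 1F 2F _   = qr
    f-adjacent 1F 3F _   = qs
    f-adjacent 2F 0F _   = flip-adj pr
    f-adjacent 2F 1F _   = flip-adj qr
    f-adjacent 2F 2F i≢j = contradiction refl i≢j
    f-adjacent 2F 3F _   = rs
    f-adjacent 3F 0F _   = flip-adj ps
    f-adjacent 3F 1F _   = flip-adj qs
    f-adjacent 3F 2F _   = flip-adj rs
    f-adjacent 3F 3F i≢j = contradiction refl i≢j

-- Vertex deletion and reduction to large minimum degree.

degree-sum : ∀ {n} → Graph n → ℕ
degree-sum G = sum (λ i → count (adj G i))

delete : ∀ {n} → Graph (suc n) → Fin (suc n) → Graph n
delete G v = record
  { adj     = λ i j → adj G (punchIn v i) (punchIn v j)
  ; adj-sym = λ i j → adj-sym G (punchIn v i) (punchIn v j)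
  ; irrefl  = λ i → irrefl G (punchIn v i)
  }

-- Row and column `v` are removed from the adjacency matrix. By symmetry and the zero diagonal, each
-- accounts for the degree of `v`.
degree-sum-delete : ∀ {n} (G : Graph (suc n)) v →
  degree-sum G ≡ count (adj G v) + (count (adj G v) + degree-sum (delete G v))
degree-sum-delete {n} G v = begin
  degree-sum G
    ≡⟨ sum-remove {i = v} (λ i → count (adj G i)) ⟩
  count (adj G v) + sum (λ i → count (adj G (punchIn v i)))
    ≡⟨ cong (count (adj G v) +_) (sum-cong-≗ λ i → sum-remove {i = v} (χ ∘ adj G (punchIn v i))) ⟩
  count (adj G v) + sum (λ i → χ (adj G (punchIn v i) v) + count (adj (delete G v) i))
    ≡⟨ cong (count (adj G v) +_) (∑-distrib-+ {n} _ _) ⟩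
  count (adj G v) + (sum (λ i → χ (adj G (punchIn v i) v)) + degree-sum (delete G v))
    ≡⟨ cong (λ d → count (adj G v) + (d + degree-sum (delete G v))) column ⟩
  count (adj G v) + (count (adj G v) + degree-sum (delete G v)) ∎
  where
  open ≡-Reasoning
  column : sum (λ i → χ (adj G (punchIn v i) v)) ≡ count (adj G v)
  column = begin
    sum (λ i → χ (adj G (punchIn v i) v))
      ≡⟨ sum-cong-≗ (λ i → cong χ (adj-sym G (punchIn v i) v)) ⟩
    sum (λ i → χ (adj G v (punchIn v i)))
      ≡⟨ cong (λ b → χ b + sum (λ i → χ (adj G v (punchIn v i)))) (irrefl G v) ⟨
    χ (adj G v v) + sum (λ i → χ (adj G v (punchIn v i)))
      ≡⟨ sum-remove {i = v} (χ ∘ adj G v) ⟨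
    count (adj G v) ∎

-- Deleting a vertex of degree below (n + E) / 4 preserves the density hypothesis, so the minimum
-- degree may be assumed to be at least (n + E) / 4.
K₄-or-independent : ∀ a E → 1 ≤ a → (∀ k → k ≤ 300000 → k * a ≤ E) →
  ∀ {n} (G : Graph n) → 1 ≤ n → n * n + 2 * E * n ≤ 4 * degree-sum G →
  HasClique G 4 ⊎ HasIndependentSet G (suc a)
K₄-or-independent a E 1≤a E-large {suc m} G 1≤n dense
  with any? (λ v → 4 * count (adj G v) <? suc m + E)
... | no none = Sum.[ inj₁ , (λ K₄-free → Sum.[ inj₂ , (λ edge-in → ⊥-elim
        (MinimumDegree.inconsistent G a E K₄-free edge-in (λ v → ≮⇒≥ λ low → none (v , low))
          1≤a E-large 1≤n)) ]′ (independent-set? G a)) ]′ (K₄? G)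
... | yes (v , low) = by-size m G v low dense
  where
  by-size : ∀ m (G : Graph (suc m)) v → 4 * count (adj G v) < suc m + E →
    suc m * suc m + 2 * E * suc m ≤ 4 * degree-sum G → HasClique G 4 ⊎ HasIndependentSet G (suc a)
  -- One vertex has degree sum 0, against a density bound of at least 1, so deletion never empties
  -- the graph.
  by-size zero G v low dense = contradiction
    (≤-trans (s≤s z≤n) (≤-trans dense (≤-reflexive (cong (4 *_) single-vertex)))) λ ()
    where
    single-vertex : degree-sum G ≡ 0
    single-vertex rewrite irrefl G zero = refl
  by-size (suc m) G v low dense =
    Sum.map (restore (adj G) true) (restore (adj G) false)
      (K₄-or-independent a E 1≤a E-large (delete G v) (s≤s z≤n)
        (arithmetic (suc m) (count (adj G v)) (degree-sum G) (degree-sum (delete G v))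
          (degree-sum-delete G v) low dense))
    where
    -- The relation and the value `b` are arbitrary, so that cliques and independent sets are both
    -- covered.
    restore : ∀ (R : Fin (suc (suc m)) → Fin (suc (suc m)) → Bool) b {k} →
      (∃ λ (f : Fin k → Fin (suc m)) → Injective _≡_ _≡_ f ×
        (∀ i j → i ≢ j → R (punchIn v (f i)) (punchIn v (f j)) ≡ b)) →
      (∃ λ (f : Fin k → Fin (suc (suc m))) → Injective _≡_ _≡_ f × (∀ i j → i ≢ j → R (f i) (f j) ≡ b))
    restore R b (f , f-injective , f-adj) =
      punchIn v ∘ f , f-injective ∘ punchIn-injective v _ _ , f-adj
    -- The left side drops by 2m + 1 + 2E, the right side by 8d ≤ 2m + 2E.
    arithmetic : ∀ m d t t′ → t ≡ d + (d + t′) → 4 * d < 1 + m + E →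
      (1 + m) * (1 + m) + 2 * E * (1 + m) ≤ 4 * t → m * m + 2 * E * m ≤ 4 * t′
    arithmetic m d _ t′ refl low dense = linear 1 1 (dense ⊕ 2 ⊙ low)
      (solve (m ∷ d ∷ t′ ∷ E ∷ []))

-- Edge count and degree sum.

sum-allFin : ∀ {n} (f : Fin n → ℕ) → ListAction.sum (List.map f (List.allFin n)) ≡ sum f
sum-allFin f = trans (cong ListAction.sum (map-tabulate id f)) (sum-tabulate f)
  where
  sum-tabulate : ∀ {n} (f : Fin n → ℕ) → ListAction.sum (List.tabulate f) ≡ sum f
  sum-tabulate {zero}  f = refl
  sum-tabulate {suc n} f = cong (f zero +_) (sum-tabulate (f ∘ suc))

-- The strict upper triangle of the adjacency matrix and its transpose do not overlap.
2*edgeCount≤degree-sum : ∀ {n} (G : Graph n) → 2 * edgeCount G ≤ degree-sum G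
2*edgeCount≤degree-sum {n} G = begin
  2 * edgeCount G
    ≡⟨ cong (2 *_) (trans (sum-allFin row) (sum-cong-≗ λ i → sum-allFin (above i))) ⟩
  e + (e + 0)
    ≡⟨ cong (e +_) (trans (+-identityʳ e) (∑-comm {n} {n} _)) ⟩
  e + sum (λ i → sum (λ j → above j i))
    ≡⟨ trans (sum-cong-≗ {n} λ i → ∑-distrib-+ {n} (above i) (λ j → above j i)) (∑-distrib-+ {n} _ _) ⟨
  sum (λ i → sum (λ j → above i j + above j i))
    ≤⟨ sum-mono {n} (λ i → sum-mono {n} (once i)) ⟩
  degree-sum G ∎
  where
  open ≤-Reasoning
  above : Fin n → Fin n → ℕ
  above i j = χ (does (i Fin.<? j) ∧ adj G i j)
  row : Fin n → ℕ
  row i = ListAction.sum (List.map (above i) (List.allFin n))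
  e = sum (λ i → sum (above i))
  once : ∀ i j → above i j + above j i ≤ χ (adj G i j)
  once i j rewrite adj-sym G j i
    with Fin.toℕ i <ᵇ Fin.toℕ j in i<j | Fin.toℕ j <ᵇ Fin.toℕ i in j<i
  ... | false | false = z≤n
  ... | false | true  = ≤-refl
  ... | true  | false = ≤-reflexive (+-identityʳ _)
  ... | true  | true  = contradiction (<ᵇ-true⇒< {Fin.toℕ j} j<i)
                                      (<-asym (<ᵇ-true⇒< {Fin.toℕ i} i<j))

-- Passage from rational to natural inequalities.

-- `ℕ→ℚ` normalises by a gcd that is stuck on a variable; identities are therefore checked on
-- unnormalised fractions.
toℚᵘ-ℕ→ℚ : ∀ k → toℚᵘ (ℕ→ℚ k) ℚᵘ.≃ mkℚᵘ (ℤ.+ k) 0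
toℚᵘ-ℕ→ℚ k = ℚ.toℚᵘ-fromℚᵘ (mkℚᵘ (ℤ.+ k) 0)

ℕ→ℚ-+ : ∀ x y → ℕ→ℚ (x + y) ≡ ℕ→ℚ x ℚ.+ ℕ→ℚ y
ℕ→ℚ-+ x y = ℚ.toℚᵘ-injective (begin
  toℚᵘ (ℕ→ℚ (x + y))                ≈⟨ toℚᵘ-ℕ→ℚ (x + y) ⟩
  mkℚᵘ (ℤ.+ (x + y)) 0                ≈⟨ ℚᵘ.*≡* (cong (ℤ._* ℤ.+ 1) (cong₂ ℤ._+_ (ℤ.*-identityʳ (ℤ.+ x)) (ℤ.*-identityʳ (ℤ.+ y)))) ⟨
  mkℚᵘ (ℤ.+ x) 0 ℚᵘ.+ mkℚᵘ (ℤ.+ y) 0    ≈⟨ ℚᵘ.+-cong (toℚᵘ-ℕ→ℚ x) (toℚᵘ-ℕ→ℚ y) ⟨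
  toℚᵘ (ℕ→ℚ x) ℚᵘ.+ toℚᵘ (ℕ→ℚ y)    ≈⟨ ℚ.toℚᵘ-homo-+ (ℕ→ℚ x) (ℕ→ℚ y) ⟨
  toℚᵘ (ℕ→ℚ x ℚ.+ ℕ→ℚ y)            ∎)
  where open ℚᵘ.≃-Reasoning

ℕ→ℚ-* : ∀ x y → ℕ→ℚ (x * y) ≡ ℕ→ℚ x ℚ.* ℕ→ℚ y
ℕ→ℚ-* x y = ℚ.toℚᵘ-injective (begin
  toℚᵘ (ℕ→ℚ (x * y))                ≈⟨ toℚᵘ-ℕ→ℚ (x * y) ⟩
  mkℚᵘ (ℤ.+ (x * y)) 0                ≈⟨ ℚᵘ.*≡* (cong (ℤ._* ℤ.+ 1) (ℤ.pos-* x y)) ⟩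
  mkℚᵘ (ℤ.+ x) 0 ℚᵘ.* mkℚᵘ (ℤ.+ y) 0    ≈⟨ ℚᵘ.*-cong (toℚᵘ-ℕ→ℚ x) (toℚᵘ-ℕ→ℚ y) ⟨
  toℚᵘ (ℕ→ℚ x) ℚᵘ.* toℚᵘ (ℕ→ℚ y)    ≈⟨ ℚ.toℚᵘ-homo-* (ℕ→ℚ x) (ℕ→ℚ y) ⟨
  toℚᵘ (ℕ→ℚ x ℚ.* ℕ→ℚ y)            ∎)
  where open ℚᵘ.≃-Reasoning

ℕ→ℚ-cancel-≤ : ∀ {x y} → ℕ→ℚ x ℚ.≤ ℕ→ℚ y → x ≤ y
ℕ→ℚ-cancel-≤ {x} {y} x≤y = ℤ.drop‿+≤+ (subst₂ ℤ._≤_ (ℤ.*-identityʳ (ℤ.+ x)) (ℤ.*-identityʳ (ℤ.+ y))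
  (ℚᵘ.drop-*≤* (begin
    mkℚᵘ (ℤ.+ x) 0    ≃⟨ toℚᵘ-ℕ→ℚ x ⟨
    toℚᵘ (ℕ→ℚ x)    ≤⟨ ℚ.toℚᵘ-mono-≤ x≤y ⟩
    toℚᵘ (ℕ→ℚ y)    ≃⟨ toℚᵘ-ℕ→ℚ y ⟩
    mkℚᵘ (ℤ.+ y) 0    ∎)))
  where open ℚᵘ.≤-Reasoning

ℕ-floor : ∀ α → α ℚ.< ℕ→ℚ 0 ⊎ ∃ λ a → ℕ→ℚ a ℚ.≤ α × α ℚ.< ℕ→ℚ (suc a)
ℕ-floor (mkℚ ℤ.-[1+ m ] d c) = inj₁ (ℚ.*<* ℤ.-<+)
ℕ-floor α@(mkℚ (ℤ.+ m) d c) = inj₂ (a ,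
  ℚ.toℚᵘ-cancel-≤ (ℚᵘ.≤-respˡ-≃ (ℚᵘ.≃-sym (toℚᵘ-ℕ→ℚ a)) (ℚᵘ.*≤* lower)) ,
  ℚ.toℚᵘ-cancel-< (ℚᵘ.<-respʳ-≃ (ℚᵘ.≃-sym (toℚᵘ-ℕ→ℚ (suc a))) (ℚᵘ.*<* upper)))
  where
  a = m / suc d
  lower : ℤ.+ a ℤ.* ℤ.+ suc d ℤ.≤ ℤ.+ m ℤ.* ℤ.+ 1
  lower = subst₂ ℤ._≤_ (ℤ.pos-* a (suc d)) (sym (ℤ.*-identityʳ (ℤ.+ m))) (ℤ.+≤+ (m/n*n≤m m (suc d)))
  upper : ℤ.+ m ℤ.* ℤ.+ 1 ℤ.< ℤ.+ suc a ℤ.* ℤ.+ suc d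
  upper = subst₂ ℤ._<_ (sym (ℤ.*-identityʳ (ℤ.+ m))) (ℤ.pos-* (suc a) (suc d)) (ℤ.+<+ (begin-strict
    m                            ≡⟨ m≡m%n+[m/n]*n m (suc d) ⟩
    m % suc d + a * suc d        <⟨ +-monoˡ-< (a * suc d) (m%n<n m (suc d)) ⟩
    suc a * suc d                ∎))
    where open ≤-Reasoning

-- Replacing α by its floor `a` only weakens the bound, after which everything is a natural number
-- times 1 / 8.
clear-denominators : ∀ K α a n e → ℕ→ℚ a ℚ.≤ α →
  (ℕ→ℚ n ℚ.* ℕ→ℚ n) ℚ.* (ℤ.+ 1 ℚ./ 8) ℚ.+ ℕ→ℚ K ℚ.* α ℚ.* ℕ→ℚ n ℚ.≤ ℕ→ℚ e →
  n * n + 8 * (K * a * n) ≤ 8 * e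
clear-denominators K α a n e a≤α h = ℕ→ℚ-cancel-≤ (let open ℚ.≤-Reasoning in begin
  ℕ→ℚ (n * n + 8 * (K * a * n))
    ≡⟨ trans (ℕ→ℚ-+ (n * n) (8 * (K * a * n))) (cong₂ ℚ._+_ (ℕ→ℚ-* n n)
         (trans (ℕ→ℚ-* 8 (K * a * n)) (cong (ℕ→ℚ 8 ℚ.*_)
           (trans (ℕ→ℚ-* (K * a) n) (cong (ℚ._* N) (ℕ→ℚ-* K a)))))) ⟩
  N ℚ.* N ℚ.+ ℕ→ℚ 8 ℚ.* (ℕ→ℚ K ℚ.* ℕ→ℚ a ℚ.* N)
    ≡⟨ cong (ℚ._+ ℕ→ℚ 8 ℚ.* (ℕ→ℚ K ℚ.* ℕ→ℚ a ℚ.* N)) eighth ⟨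
  ℕ→ℚ 8 ℚ.* (N ℚ.* N ℚ.* (ℤ.+ 1 ℚ./ 8)) ℚ.+ ℕ→ℚ 8 ℚ.* (ℕ→ℚ K ℚ.* ℕ→ℚ a ℚ.* N)
    ≡⟨ ℚ.*-distribˡ-+ (ℕ→ℚ 8) (N ℚ.* N ℚ.* (ℤ.+ 1 ℚ./ 8)) _ ⟨
  ℕ→ℚ 8 ℚ.* (N ℚ.* N ℚ.* (ℤ.+ 1 ℚ./ 8) ℚ.+ ℕ→ℚ K ℚ.* ℕ→ℚ a ℚ.* N)
    ≤⟨ ℚ.*-monoˡ-≤-nonNeg (ℕ→ℚ 8) (ℚ.≤-trans (ℚ.+-monoʳ-≤ (N ℚ.* N ℚ.* (ℤ.+ 1 ℚ./ 8))
         (ℚ.*-monoʳ-≤-nonNeg N {{ℚ.normalize-nonNeg n 1}}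
           (ℚ.*-monoˡ-≤-nonNeg (ℕ→ℚ K) {{ℚ.normalize-nonNeg K 1}} a≤α))) h) ⟩
  ℕ→ℚ 8 ℚ.* ℕ→ℚ e
    ≡⟨ ℕ→ℚ-* 8 e ⟨
  ℕ→ℚ (8 * e) ∎)
  where
  N = ℕ→ℚ n
  eighth : ℕ→ℚ 8 ℚ.* (N ℚ.* N ℚ.* (ℤ.+ 1 ℚ./ 8)) ≡ N ℚ.* N
  eighth = let open ≡-Reasoning in begin
    ℕ→ℚ 8 ℚ.* (N ℚ.* N ℚ.* (ℤ.+ 1 ℚ./ 8))    ≡⟨ ℚ.*-comm (ℕ→ℚ 8) (N ℚ.* N ℚ.* (ℤ.+ 1 ℚ./ 8)) ⟩
    N ℚ.* N ℚ.* (ℤ.+ 1 ℚ./ 8) ℚ.* ℕ→ℚ 8      ≡⟨ ℚ.*-assoc (N ℚ.* N) (ℤ.+ 1 ℚ./ 8) (ℕ→ℚ 8) ⟩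
    N ℚ.* N ℚ.* ℚ.1ℚ                         ≡⟨ ℚ.*-identityʳ (N ℚ.* N) ⟩
    N ℚ.* N                                  ∎

-- The theorem for every constant from 300000 on, and for 10^10.

ramsey-turán : ∀ K → 300000 ≤ K → (α : ℚ) (n : ℕ) → n ≥ 1 → (G : Graph n) →
  (ℕ→ℚ n ℚ.* ℕ→ℚ n) ℚ.* (ℤ.+ 1 ℚ./ 8) ℚ.+ ℕ→ℚ K ℚ.* α ℚ.* ℕ→ℚ n ℚ.≤ ℕ→ℚ (edgeCount G) →
  HasClique G 4 ⊎ Σ ℕ (λ k → (α ℚ.< ℕ→ℚ k) × HasIndependentSet G k)
ramsey-turán K K-large α n n≥1 G dense with ℕ-floor α
-- For negative α the empty set suffices; for 0 ≤ α < 1, in the next case, a single vertex does. The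
-- remaining case has a ≥ 1.
... | inj₁ α<0 = inj₂ (0 , α<0 , (λ ()) , (λ { {()} }) , λ ())
... | inj₂ (zero , _ , α<1) = inj₂ (1 , α<1 , (λ _ → fromℕ< n≥1) ,
  (λ { {0F} {0F} _ → refl }) , λ { 0F 0F i≢j → contradiction refl i≢j })
... | inj₂ (a@(suc _) , a≤α , α<1+a) = Sum.map₂ (λ independent → suc a , α<1+a , independent)
  -- With E = 4Ka, the term 2En equals 8Kan, which is what K a n becomes after multiplication by 8.
  (K₄-or-independent a (4 * (K * a)) (s≤s z≤n) E-large G n≥1
    (arithmetic K a (edgeCount G) (degree-sum G) (clear-denominators K α a n (edgeCount G) a≤α dense)
      (2*edgeCount≤degree-sum G)))
  where
  E-large : ∀ k → k ≤ 300000 → k * a ≤ 4 * (K * a)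
  E-large k k≤ = ≤-trans (*-monoˡ-≤ a (≤-trans k≤ K-large)) (m≤m+n (K * a) _)
  arithmetic : ∀ K a e t → n * n + 8 * (K * a * n) ≤ 8 * e → 2 * e ≤ t →
    n * n + 2 * (4 * (K * a)) * n ≤ 4 * t
  arithmetic K a e t h₁ h₂ = linear 1 0 (h₁ ⊕ 4 ⊙ h₂) (solve (K ∷ a ∷ n ∷ e ∷ t ∷ []))

theorem1p5 : (α : ℚ) (n : ℕ) → n ≥ 1 → (G : Graph n) →
    (ℕ→ℚ n ℚ.* ℕ→ℚ n) ℚ.* (ℤ.+ 1 ℚ./ 8) ℚ.+ C ℚ.* α ℚ.* ℕ→ℚ n ℚ.≤ ℕ→ℚ (edgeCount G) →
    HasClique G 4 ⊎ Σ ℕ (λ k → (α ℚ.< ℕ→ℚ k) × HasIndependentSet G k)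
theorem1p5 = ramsey-turán (10 ^ 10) (≤ᵇ⇒≤ 300000 (10 ^ 10) _)
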